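{- Let $n\geq 1$. Then $H_n(x)=\sum_{i=0}^{n}e(i,n)x^i$, where, with $C(a,b)=\binom{a}{b}$, $$e(i,n)=\begin{cases}3^{i}, & 0\leq i\leq n-\lfloor n/2\rfloor-1,\\[4pt] \dfrac{2^{n}C(i,n-i)}{2^{i+1}}+3^{i}\left(1+2^{n}\displaystyle\sum_{j=n-\lfloor n/2\rfloor}^{i}\frac{2n-5j}{j\,6^{j}}C(j,n-j)\right), & n-\lfloor n/2\rfloor\leq i\leq n-1,\\[4pt] 1, & i=n.\end{cases}$$
   Context: The Stern polynomials $B_n(t)\in\mathbb{Z}[t]$ are defined by $B_0(t)=0$, $B_1(t)=1$, and for $n\geq 1$: $B_{2n}(t)=tB_n(t)$, $B_{2n+1}(t)=B_n(t)+B_{n+1}(t)$. For $n\geq1$ let $e(n)=\deg B_n(t)$. For $n\geq 0$ let $H_n(x)=\sum_{m=1}^{2^n}x^{e(m)}$ and for $i,n\geq0$ let $e(i,n)=|\{m\in[1,2^n]\cap\mathbb{Z}:\;e(m)=i\}|$. -}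

module Defs where

open import Data.Bool.Base using (if_then_else_)
open import Data.Empty using (⊥-elim)
open import Data.Integer.Base as ℤ using (ℤ; +_; 0ℤ; 1ℤ)
import Data.Integer.Properties as ℤₚ
open import Data.List.Base using (List; []; _∷_; _++_; map; foldr; filter; length; upTo; replicate)
open import Data.List.Relation.Unary.All as All using (All; []; _∷_)
open import Data.List.Relation.Unary.Any using (Any; here; there)
open import Data.Nat.Base hiding (parity)
open import Data.Nat.Combinatorics using (_C_)
open import Data.Nat.Induction using (Acc; acc; <-wellFounded)
import Data.Nat.Properties as ℕₚ
open import Data.Product.Base using (_×_; _,_; proj₁; proj₂)
open import Data.Rational.Base as ℚ using (ℚ; 0ℚ)
open import Relation.Binary.PropositionalEquality
open import Relation.Nullary using (¬_; Dec; yes; no; does; contradiction)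

-- ℤ[t] as coefficient lists, constant term first.  Trailing zeros are
-- allowed, so equality of polynomials is _≈ₚ_, not _≡_.

Poly : Set
Poly = List ℤ

coeff : Poly → ℕ → ℤ
coeff []      _       = 0ℤ
coeff (a ∷ p) zero    = a
coeff (a ∷ p) (suc k) = coeff p k

infix 4 _≈ₚ_
_≈ₚ_ : Poly → Poly → Set
p ≈ₚ q = ∀ k → coeff p k ≡ coeff q k

infixl 6 _+ₚ_
_+ₚ_ : Poly → Poly → Poly
[]      +ₚ q       = q
(a ∷ p) +ₚ []      = a ∷ p
(a ∷ p) +ₚ (b ∷ q) = (a ℤ.+ b) ∷ (p +ₚ q)

infixr 7 t·_
t·_ : Poly → Poly
t· p = 0ℤ ∷ p

monomial : ℤ → ℕ → Poly
monomial c i = replicate i 0ℤ ++ (c ∷ [])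

sumₚ : List Poly → Poly
sumₚ = foldr _+ₚ_ []

allZero? : (p : Poly) → Dec (All (_≡ 0ℤ) p)
allZero? = All.all? (ℤₚ._≟ 0ℤ)

-- The zero polynomial gets degree 0; e-isDegree below shows that this
-- convention is never used for B m with m ≥ 1.
deg : Poly → ℕ
deg []      = 0
deg (a ∷ p) = if does (allZero? p) then 0 else suc (deg p)

data Parity : ℕ → Set where
  even : ∀ h → Parity (2 * h)
  odd  : ∀ h → Parity (suc (2 * h))

parity : ∀ n → Parity n
parity zero = even 0
parity (suc n) with parity n
... | even h = odd h
... | odd h  = subst Parity (ℕₚ.*-suc 2 h) (even (suc h))

private
  half< : ∀ h → suc h < 2 * suc h
  half< h = ℕₚ.m<m+n (suc h) (s≤s z≤n)

B-acc : ∀ n → Acc _<_ n → Poly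
B-acc n (acc rs) with parity n
... | even zero    = []
... | odd zero     = 1ℤ ∷ []
... | even (suc h) = t· B-acc (suc h) (rs (half< h))
... | odd (suc h)  = B-acc (suc h) (rs (ℕₚ.m<n⇒m<1+n (half< h)))
                  +ₚ B-acc (suc (suc h)) (rs (s≤s (half< h)))

B : ℕ → Poly
B n = B-acc n (<-wellFounded n)

e : ℕ → ℕ
e m = deg (B m)

range₁ : ℕ → List ℕ
range₁ k = map suc (upTo k)

H : ℕ → Poly
H n = sumₚ (map (λ m → monomial 1ℤ (e m)) (range₁ (2 ^ n)))

-- This is e(i,n) = |{ m ∈ [1,2ⁿ] : e(m) = i }|
eCount : ℕ → ℕ → ℕ
eCount i n = length (filter (λ m → e m ℕₚ.≟ i) (range₁ (2 ^ n)))

fromℕ : ℕ → ℚ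
fromℕ k = + k ℚ./ 1

sumFrom : (a len : ℕ) .{{_ : NonZero a}} → ((j : ℕ) .{{_ : NonZero j}} → ℚ) → ℚ
sumFrom a zero      f = 0ℚ
sumFrom a (suc len) f = f a ℚ.+ sumFrom (suc a) len f

-- Σ_{j=a}^{b} f(j), empty if b < a
sumFromTo : (a b : ℕ) .{{_ : NonZero a}} → ((j : ℕ) .{{_ : NonZero j}} → ℚ) → ℚ
sumFromTo a b f = sumFrom a (suc b ∸ a) f

private
  halfUp-suc : ∀ k → suc k ∸ ⌊ suc k /2⌋ ≢ 0
  halfUp-suc k eq = ℕₚ.<⇒≱ (ℕₚ.⌊n/2⌋<n k) (ℕₚ.m∸n≡0⇒m≤n eq)

halfUp≢0 : ∀ n .{{_ : NonZero n}} → NonZero (n ∸ ⌊ n /2⌋)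
halfUp≢0 (suc k) = ≢-nonZero (halfUp-suc k)

j6ʲ≢0 : ∀ j .{{_ : NonZero j}} → NonZero (j * 6 ^ j)
j6ʲ≢0 j@(suc _) = ℕₚ.m*n≢0 j (6 ^ j) {{_}} {{ℕₚ.m^n≢0 6 j}}

-- (2n − 5j) / (j 6ʲ) · C(j, n − j), used only for j ≤ n
summand : ℕ → (j : ℕ) .{{_ : NonZero j}} → ℚ
summand n j = ((+ (2 * n) ℤ.- + (5 * j)) ℚ./ (j * 6 ^ j)) {{j6ʲ≢0 j}}
              ℚ.* fromℕ (j C (n ∸ j))

-- 2ⁿ C(i, n − i) / 2ⁱ⁺¹ + 3ⁱ (1 + 2ⁿ Σ_{j = n − ⌊n/2⌋}^{i} (2n − 5j) / (j 6ʲ) · C(j, n − j)),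
-- used only for i ≤ n
middleValue : (n : ℕ) .{{_ : NonZero n}} → ℕ → ℚ
middleValue n i =
  (+ (2 ^ n * (i C (n ∸ i))) ℚ./ (2 ^ suc i)) {{ℕₚ.m^n≢0 2 (suc i)}}
  ℚ.+ fromℕ (3 ^ i) ℚ.* (ℚ.1ℚ ℚ.+ fromℕ (2 ^ n) ℚ.* sumFromTo (n ∸ ⌊ n /2⌋) i {{halfUp≢0 n}} (λ j → summand n j))

private
  B-irr : ∀ n (a b : Acc _<_ n) → B-acc n a ≡ B-acc n b
  B-irr n (acc rs) (acc rs′) with parity n
  ... | even zero    = refl
  ... | odd zero     = refl
  ... | even (suc h) = cong t·_ (B-irr (suc h) (rs (half< h)) (rs′ (half< h)))
  ... | odd (suc h)  = cong₂ _+ₚ_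
    (B-irr (suc h) (rs (ℕₚ.m<n⇒m<1+n (half< h))) (rs′ (ℕₚ.m<n⇒m<1+n (half< h))))
    (B-irr (suc (suc h)) (rs (s≤s (half< h))) (rs′ (s≤s (half< h))))

  B-acc-even : ∀ n a h → n ≡ 2 * suc h → B-acc n a ≡ t· B (suc h)
  B-acc-even n (acc rs) h eq with parity n
  ... | odd k = contradiction (sym eq) (ℕₚ.even≢odd (suc h) k)
  ... | even k with ℕₚ.*-cancelˡ-≡ k (suc h) 2 eq
  ...   | refl = cong t·_ (B-irr (suc h) (rs (half< h)) (<-wellFounded (suc h)))

  B-acc-odd : ∀ n a h → n ≡ suc (2 * suc h) → B-acc n a ≡ B (suc h) +ₚ B (suc (suc h))
  B-acc-odd n (acc rs) h eq with parity n
  ... | even k = contradiction eq (ℕₚ.even≢odd k (suc h))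
  ... | odd k with ℕₚ.*-cancelˡ-≡ k (suc h) 2 (ℕₚ.suc-injective eq)
  ...   | refl = cong₂ _+ₚ_
    (B-irr (suc h) (rs (ℕₚ.m<n⇒m<1+n (half< h))) (<-wellFounded (suc h)))
    (B-irr (suc (suc h)) (rs (s≤s (half< h))) (<-wellFounded (suc (suc h))))

B-zero : B 0 ≡ []
B-zero = refl

B-one : B 1 ≡ 1ℤ ∷ []
B-one = refl

B-even : ∀ n .{{_ : NonZero n}} → B (2 * n) ≡ t· B n
B-even (suc h) = B-acc-even _ _ h refl

B-odd : ∀ n .{{_ : NonZero n}} → B (suc (2 * n)) ≡ B n +ₚ B (suc n)
B-odd (suc h) = B-acc-odd _ _ h refl

private
  Positive : Poly → Set
  Positive p = All (0ℤ ℤ.≤_) p × Any (0ℤ ℤ.<_) p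

  +ₚ-nonNeg : ∀ {p q} → All (0ℤ ℤ.≤_) p → All (0ℤ ℤ.≤_) q → All (0ℤ ℤ.≤_) (p +ₚ q)
  +ₚ-nonNeg []       qs       = qs
  +ₚ-nonNeg (a ∷ ps) []       = a ∷ ps
  +ₚ-nonNeg (a ∷ ps) (b ∷ qs) = ℤₚ.+-mono-≤ a b ∷ +ₚ-nonNeg ps qs

  +ₚ-pos : ∀ {p q} → Any (0ℤ ℤ.<_) p → All (0ℤ ℤ.≤_) q → Any (0ℤ ℤ.<_) (p +ₚ q)
  +ₚ-pos (here a)  []       = here a
  +ₚ-pos (there x) []       = there x
  +ₚ-pos (here a)  (b ∷ qs) = here (ℤₚ.+-mono-<-≤ a b)
  +ₚ-pos (there x) (b ∷ qs) = there (+ₚ-pos x qs)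

  B-acc-positive : ∀ n a → n ≢ 0 → Positive (B-acc n a)
  B-acc-positive n (acc rs) n≢0 with parity n
  ... | even zero    = ⊥-elim (n≢0 refl)
  ... | odd zero     = ℤ.+≤+ z≤n ∷ [] , here (ℤ.+<+ (s≤s z≤n))
  ... | even (suc h) = let ps , x = B-acc-positive (suc h) (rs (half< h)) (λ ()) in
                       ℤ.+≤+ z≤n ∷ ps , there x
  ... | odd (suc h)  =
    let ps , x = B-acc-positive (suc h) (rs (ℕₚ.m<n⇒m<1+n (half< h))) (λ ())
        qs , _ = B-acc-positive (suc (suc h)) (rs (s≤s (half< h))) (λ ())
    in +ₚ-nonNeg ps qs , +ₚ-pos x qs

  positive⇒nonZero : ∀ {p} → Any (0ℤ ℤ.<_) p → ¬ All (_≡ 0ℤ) p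
  positive⇒nonZero (here 0<a) (a≡0 ∷ _) = ℤₚ.<⇒≢ 0<a (sym a≡0)
  positive⇒nonZero (there x)  (_ ∷ zs)  = positive⇒nonZero x zs

  allZero⇒coeff : ∀ {p} → All (_≡ 0ℤ) p → ∀ k → coeff p k ≡ 0ℤ
  allZero⇒coeff []       k       = refl
  allZero⇒coeff (z ∷ zs) zero    = z
  allZero⇒coeff (z ∷ zs) (suc k) = allZero⇒coeff zs k

  deg-lead : ∀ p → ¬ All (_≡ 0ℤ) p → coeff p (deg p) ≢ 0ℤ
  deg-lead []      nz eq = nz []
  deg-lead (a ∷ p) nz eq with allZero? p
  ... | yes zs = nz (eq ∷ zs)
  ... | no nz′ = deg-lead p nz′ eq

  deg-above : ∀ p k → deg p < k → coeff p k ≡ 0ℤ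
  deg-above []      k       lt = refl
  deg-above (a ∷ p) (suc k) lt with allZero? p
  ... | yes zs = allZero⇒coeff zs k
  ... | no _   = deg-above p k (s≤s⁻¹ lt)

e-isDegree : ∀ m .{{_ : NonZero m}} →
             coeff (B m) (e m) ≢ 0ℤ × (∀ k → e m < k → coeff (B m) k ≡ 0ℤ)
e-isDegree m@(suc _) =
  deg-lead (B m) (positive⇒nonZero (proj₂ (B-acc-positive m _ (λ ())))) , deg-above (B m)

{-# OPTIONS --safe #-}
module Submission where

-- Since |e(m+1) − e(m)| ≤ 1, one has e(4m+1) = e(m) + 1 and e(4m+3) = e(m+1) + 1, so that
--   e(i+1, n+2) + [n = i] = e(i, n+1) + 2 e(i, n).
-- With n = i + k and k ≥ 1 this is solved by
--   e(i, n) = P(i, k) + 2ᵏ⁻¹ C(i, k),   P(i, k) = Σ_{l < k} 2ˡ C(i, l).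
-- For k > i the binomial theorem gives P(i, k) = 3ⁱ and the last term vanishes.  Otherwise
--   P(i+1, k) = 3 P(i, k+1) − 2ᵏ (C(i+1, k) + 2 C(i, k)),
-- and as (i+1) C(i, k) = (i+1−k) C(i+1, k), the subtrahend divided by 3ⁱ⁺¹ 2ⁿ is minus the
-- summand j = i + 1 of the sum in the statement, which therefore telescopes.

open import Defs
open import Data.Bool.Base using (true; false; if_then_else_)
open import Data.Empty using (⊥-elim)
open import Data.Integer.Base as ℤ using (+_; 0ℤ; 1ℤ)
import Data.Integer.Properties as ℤₚ
open import Data.List.Base using ([]; _∷_; _++_; _∷ʳ_; map; upTo; filter; length)
open import Data.List.Properties using (upTo-∷ʳ; map-++; filter-++; length-++)
open import Data.Nat.Base using (ℕ; zero; suc; _+_; _*_; _∸_; _^_; _⊔_; _≤_; _<_; z≤n; s≤s; s≤s⁻¹; _≡ᵇ_; ⌊_/2⌋; ⌈_/2⌉; NonZero)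
open import Data.Nat.Combinatorics using (_C_; nCk+nC[k+1]≡[n+1]C[k+1]; k>n⇒nCk≡0; nC1≡n)
open import Data.Nat.Induction using (Acc; acc; <-wellFounded)
import Data.Nat.Properties as ℕₚ
open import Data.Nat.Tactic.RingSolver using (solve-∀)
open import Data.Product.Base using (_×_; _,_; proj₁; proj₂; ∃)
open import Data.Sum.Base using (inj₁; inj₂)
open import Data.Rational.Base as ℚ using (ℚ; 0ℚ; 1ℚ)
import Data.Rational.Properties as ℚₚ
open import Data.Rational.Solver using (module +-*-Solver)
import Data.Rational.Unnormalised.Base as ℚᵘ
import Data.Rational.Unnormalised.Properties as ℚᵘₚ
open import Relation.Binary.Definitions using (tri<; tri≈; tri>)
open import Relation.Binary.PropositionalEquality
open import Relation.Nullary using (contradiction)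

open ≡-Reasoning

-- Degrees of Stern polynomials

coeff-+ₚ : ∀ p q k → coeff (p +ₚ q) k ≡ coeff p k ℤ.+ coeff q k
coeff-+ₚ []      q       k       = sym (ℤₚ.+-identityˡ (coeff q k))
coeff-+ₚ (a ∷ p) []      k       = sym (ℤₚ.+-identityʳ (coeff (a ∷ p) k))
coeff-+ₚ (a ∷ p) (b ∷ q) zero    = refl
coeff-+ₚ (a ∷ p) (b ∷ q) (suc k) = coeff-+ₚ p q k

-- Nonnegative coefficients rule out cancellation, so degrees of sums can be tracked. The degree is
-- a parameter described by coefficients, which makes it insensitive to trailing zeros.
record PositiveOfDegree (p : Poly) (d : ℕ) : Set where
  constructor positiveOfDegree
  field
    nonNeg : ∀ k → 0ℤ ℤ.≤ coeff p k
    lead   : 0ℤ ℤ.< coeff p d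
    above  : ∀ k → d < k → coeff p k ≡ 0ℤ

open PositiveOfDegree

t·-positive : ∀ {p d} → PositiveOfDegree p d → PositiveOfDegree (t· p) (suc d)
t·-positive P .nonNeg zero    = ℤₚ.≤-refl
t·-positive P .nonNeg (suc k) = P .nonNeg k
t·-positive P .lead           = P .lead
t·-positive P .above (suc k) (s≤s d<k) = P .above k d<k

+ₚ-positive-≤ : ∀ {p q c d} → c ≤ d → PositiveOfDegree p c → PositiveOfDegree q d →
                PositiveOfDegree (p +ₚ q) d
+ₚ-positive-≤ {p} {q} c≤d P Q .nonNeg k rewrite coeff-+ₚ p q k =
  ℤₚ.+-mono-≤ (P .nonNeg k) (Q .nonNeg k)
+ₚ-positive-≤ {p} {q} {d = d} c≤d P Q .lead rewrite coeff-+ₚ p q d =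
  ℤₚ.+-mono-≤-< (P .nonNeg d) (Q .lead)
+ₚ-positive-≤ {p} {q} c≤d P Q .above k d<k rewrite coeff-+ₚ p q k =
  cong₂ ℤ._+_ (P .above k (ℕₚ.≤-<-trans c≤d d<k)) (Q .above k d<k)

+ₚ-positive-≥ : ∀ {p q c d} → d ≤ c → PositiveOfDegree p c → PositiveOfDegree q d →
                PositiveOfDegree (p +ₚ q) c
+ₚ-positive-≥ {p} {q} d≤c P Q .nonNeg k rewrite coeff-+ₚ p q k =
  ℤₚ.+-mono-≤ (P .nonNeg k) (Q .nonNeg k)
+ₚ-positive-≥ {p} {q} {c = c} d≤c P Q .lead rewrite coeff-+ₚ p q c =
  ℤₚ.+-mono-<-≤ (P .lead) (Q .nonNeg c)
+ₚ-positive-≥ {p} {q} d≤c P Q .above k c<k rewrite coeff-+ₚ p q k =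
  cong₂ ℤ._+_ (P .above k c<k) (Q .above k (ℕₚ.≤-<-trans d≤c c<k))

-- At the larger of the two degrees one summand has a positive coefficient and the other a
-- nonnegative one, so the leading terms cannot cancel.
+ₚ-positive : ∀ {p q c d} → PositiveOfDegree p c → PositiveOfDegree q d →
              PositiveOfDegree (p +ₚ q) (c ⊔ d)
+ₚ-positive {c = c} {d} P Q with ℕₚ.≤-total c d
... | inj₁ c≤d rewrite ℕₚ.m≤n⇒m⊔n≡n c≤d = +ₚ-positive-≤ c≤d P Q
... | inj₂ d≤c rewrite ℕₚ.m≥n⇒m⊔n≡m d≤c = +ₚ-positive-≥ d≤c P Q

-- Induction along the Stern recursion, and the resulting recursion for degrees

binaryInduction : (P : ℕ → Set) → P 1 →
  (∀ h → P (suc h) → P (2 * suc h)) →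
  (∀ h → P (suc h) → P (suc (suc h)) → P (suc (2 * suc h))) →
  ∀ n → P (suc n)
binaryInduction P p1 pe po n = go (suc n) (<-wellFounded (suc n)) (λ ())
  where
  half< : ∀ h → suc h < 2 * suc h
  half< h = ℕₚ.m<m+n (suc h) (s≤s z≤n)

  go : ∀ m → Acc _<_ m → m ≢ 0 → P m
  go m (acc rs) m≢0 with parity m
  ... | even zero    = ⊥-elim (m≢0 refl)
  ... | odd zero     = p1
  ... | even (suc h) = pe h (go (suc h) (rs (half< h)) (λ ()))
  ... | odd (suc h)  = po h (go (suc h) (rs (ℕₚ.m<n⇒m<1+n (half< h))) (λ ()))
                            (go (suc (suc h)) (rs (s≤s (half< h))) (λ ()))

degree-unique : ∀ n {d} → PositiveOfDegree (B (suc n)) d → e (suc n) ≡ d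
degree-unique n {d} P with ℕₚ.<-cmp (e (suc n)) d
... | tri< e<d _ _ = contradiction (sym (proj₂ (e-isDegree (suc n)) d e<d)) (ℤₚ.<⇒≢ (P .lead))
... | tri≈ _ e≡d _ = e≡d
... | tri> _ _ d<e = contradiction (P .above (e (suc n)) d<e) (proj₁ (e-isDegree (suc n)))

-- Binary induction produces some degree, with maxima at the odd steps; `degree-unique` then
-- identifies it with `e`.
B-positive : ∀ n → PositiveOfDegree (B (suc n)) (e (suc n))
B-positive n = subst (PositiveOfDegree (B (suc n))) (sym (degree-unique n P)) P
  where
  exists : ∀ n → ∃ (PositiveOfDegree (B (suc n)))
  exists = binaryInduction (λ m → ∃ (PositiveOfDegree (B m)))
    (0 , positiveOfDegree (λ { zero → ℤ.+≤+ z≤n ; (suc k) → ℤₚ.≤-refl })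
                          (ℤ.+<+ (s≤s z≤n)) (λ { (suc k) _ → refl }))
    (λ h (d , P) → suc d , subst (λ p → PositiveOfDegree p (suc d)) (sym (B-even (suc h))) (t·-positive P))
    (λ h (c , P) (d , Q) → c ⊔ d ,
      subst (λ p → PositiveOfDegree p (c ⊔ d)) (sym (B-odd (suc h))) (+ₚ-positive P Q))

  P = proj₂ (exists n)

e-even : ∀ h → e (2 * suc h) ≡ suc (e (suc h))
-- The argument is the predecessor of `2 * suc h` as it unfolds.
e-even h = degree-unique (h + 1 * suc h)
  (subst (λ p → PositiveOfDegree p (suc (e (suc h)))) (sym (B-even (suc h))) (t·-positive (B-positive h)))

e-odd : ∀ h → e (suc (2 * suc h)) ≡ e (suc h) ⊔ e (suc (suc h))
e-odd h = degree-unique (2 * suc h)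
  (subst (λ p → PositiveOfDegree p (e (suc h) ⊔ e (suc (suc h)))) (sym (B-odd (suc h)))
    (+ₚ-positive (B-positive h) (B-positive (suc h))))

-- Counting

-- The Boolean test makes `δ (suc a) (suc i)` reduce to `δ a i` and `δ (suc a) 0` to 0; the count
-- recurrences use both reductions silently.
δ : ℕ → ℕ → ℕ
δ a i = if a ≡ᵇ i then 1 else 0

δ-refl : ∀ a → δ a a ≡ 1
δ-refl zero    = refl
δ-refl (suc a) = δ-refl a

δ-≢ : ∀ {a i} → a ≢ i → δ a i ≡ 0
δ-≢ {zero}  {zero}  a≢i = contradiction refl a≢i
δ-≢ {zero}  {suc i} a≢i = refl
δ-≢ {suc a} {zero}  a≢i = refl
δ-≢ {suc a} {suc i} a≢i = δ-≢ (λ a≡i → a≢i (cong suc a≡i))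

-- The newest index is added on the right, so a block of four further indices unfolds by
-- computation.
count : (ℕ → ℕ) → ℕ → ℕ → ℕ
count f i zero    = 0
count f i (suc m) = count f i m + δ (f (suc m)) i

range₁-∷ʳ : ∀ m → range₁ (suc m) ≡ range₁ m ∷ʳ suc m
range₁-∷ʳ m = trans (cong (map suc) (sym (upTo-∷ʳ m))) (map-++ suc (upTo m) (m ∷ []))

length-filter-range₁ : ∀ f i m → length (filter (λ k → f k ℕₚ.≟ i) (range₁ m)) ≡ count f i m
length-filter-range₁ f i zero = refl
length-filter-range₁ f i (suc m) = begin
  length (filter P? (range₁ (suc m)))                              ≡⟨ cong (λ xs → length (filter P? xs)) (range₁-∷ʳ m) ⟩
  length (filter P? (range₁ m ∷ʳ suc m))                           ≡⟨ cong length (filter-++ P? (range₁ m) (suc m ∷ [])) ⟩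
  length (filter P? (range₁ m) ++ filter P? (suc m ∷ []))          ≡⟨ length-++ (filter P? (range₁ m)) ⟩
  length (filter P? (range₁ m)) + length (filter P? (suc m ∷ []))  ≡⟨ cong₂ _+_ (length-filter-range₁ f i m) single ⟩
  count f i m + δ (f (suc m)) i                                    ∎
  where
  P? = λ k → f k ℕₚ.≟ i
  single : length (filter P? (suc m ∷ [])) ≡ δ (f (suc m)) i
  -- Decidable equality on ℕ computes through `_≡ᵇ_`, so one case split reduces both the filter and
  -- `δ`.
  single with f (suc m) ≡ᵇ i
  ... | true  = refl
  ... | false = refl

-- Partial sums of the expansion of (1 + 2)ⁱ

partialSum : ℕ → ℕ → ℕ
partialSum i zero    = 0
partialSum i (suc k) = partialSum i k + 2 ^ k * (i C k)

-- Pascal's rule applied termwise: the part with lowered index carries one factor 2 and stops one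
-- term earlier.
partialSum-pascal : ∀ i k → partialSum (suc i) (suc k) ≡ partialSum i (suc k) + 2 * partialSum i k
partialSum-pascal i zero    = refl
partialSum-pascal i (suc k) = begin
  partialSum (suc i) (suc k) + 2 * 2 ^ k * (suc i C suc k)
    ≡⟨ cong₂ (λ s c → s + 2 * 2 ^ k * c) (partialSum-pascal i k) (sym (nCk+nC[k+1]≡[n+1]C[k+1] i k)) ⟩
  partialSum i (suc k) + 2 * partialSum i k + 2 * 2 ^ k * (i C k + i C suc k)
    ≡⟨ rearrange (partialSum i (suc k)) (partialSum i k) (2 ^ k) (i C k) (i C suc k) ⟩
  partialSum i (suc k) + 2 * 2 ^ k * (i C suc k) + 2 * (partialSum i k + 2 ^ k * (i C k))
    ∎
  where
  rearrange : ∀ s t p c d → s + 2 * t + 2 * p * (c + d) ≡ s + 2 * p * d + 2 * (t + p * c)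
  rearrange = solve-∀

-- Once the cutoff exceeds `i`, both sums on the right of `partialSum-pascal` are full, giving 3ⁱ +
-- 2 · 3ⁱ.
partialSum-full : ∀ {i k} → i < k → partialSum i k ≡ 3 ^ i
partialSum-full {zero} {suc zero} _ = refl
partialSum-full {zero} {suc (suc k)} _ = begin
  partialSum 0 (suc k) + 2 ^ suc k * (0 C suc k)
    ≡⟨ cong₂ (λ s c → s + 2 ^ suc k * c) (partialSum-full {0} {suc k} (s≤s z≤n)) (k>n⇒nCk≡0 {0} {suc k} (s≤s z≤n)) ⟩
  1 + 2 ^ suc k * 0  ≡⟨ cong suc (ℕₚ.*-zeroʳ (2 ^ suc k)) ⟩
  1 ∎
partialSum-full {suc i} {suc k} (s≤s i<k) = begin
  partialSum (suc i) (suc k)               ≡⟨ partialSum-pascal i k ⟩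
  partialSum i (suc k) + 2 * partialSum i k ≡⟨ cong₂ (λ s t → s + 2 * t) (partialSum-full (ℕₚ.m<n⇒m<1+n i<k)) (partialSum-full i<k) ⟩
  3 ^ suc i                                ∎

-- Induction on the cutoff. Pascal's rule splits C(i+1, k+1) into C(i, k), which completes the
-- induction hypothesis, and C(i, k+1), which makes up the third copy of the new term.
partialSum-shift : ∀ i k →
  partialSum (suc i) k + 2 ^ k * ((suc i C k) + 2 * (i C k)) ≡ 3 * partialSum i (suc k)
partialSum-shift i zero    = refl
partialSum-shift i (suc k) = begin
  partialSum (suc i) k + p * (suc i C k) + 2 * p * ((suc i C suc k) + 2 * d)
    ≡⟨ cong (λ x → partialSum (suc i) k + p * (suc i C k) + 2 * p * (x + 2 * d)) (nCk+nC[k+1]≡[n+1]C[k+1] i k) ⟨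
  partialSum (suc i) k + p * (suc i C k) + 2 * p * ((c + d) + 2 * d)
    ≡⟨ rearrange (partialSum (suc i) k) p (suc i C k) c d ⟩
  (partialSum (suc i) k + p * ((suc i C k) + 2 * c)) + 3 * (2 * p * d)
    ≡⟨ cong (_+ 3 * (2 * p * d)) (partialSum-shift i k) ⟩
  3 * partialSum i (suc k) + 3 * (2 * p * d)
    ≡⟨ ℕₚ.*-distribˡ-+ 3 (partialSum i (suc k)) (2 * p * d) ⟨
  3 * (partialSum i (suc k) + 2 * p * d)
    ∎
  where
  p = 2 ^ k
  c = i C k
  d = i C suc k
  rearrange : ∀ s p x c d → s + p * x + 2 * p * ((c + d) + 2 * d) ≡ (s + p * (x + 2 * c)) + 3 * (2 * p * d)
  rearrange = solve-∀

-- Binomial identities in subtraction-free form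

C-absorb : ∀ n k → suc k * (suc n C suc k) ≡ suc n * (n C k)
C-absorb zero    zero    = refl
C-absorb zero    (suc k) = begin
  suc (suc k) * (1 C suc (suc k)) ≡⟨ cong (suc (suc k) *_) (k>n⇒nCk≡0 {1} {suc (suc k)} (s≤s (s≤s z≤n))) ⟩
  suc (suc k) * 0                 ≡⟨ ℕₚ.*-zeroʳ (suc (suc k)) ⟩
  0                               ≡⟨ cong (1 *_) (k>n⇒nCk≡0 {0} {suc k} (s≤s z≤n)) ⟨
  1 * (0 C suc k)                 ∎
C-absorb (suc n) zero    = begin
  1 * (suc (suc n) C 1)  ≡⟨ ℕₚ.*-identityˡ _ ⟩
  suc (suc n) C 1        ≡⟨ nC1≡n (suc (suc n)) ⟩
  suc (suc n)            ≡⟨ ℕₚ.*-identityʳ _ ⟨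
  suc (suc n) * 1        ∎
C-absorb (suc n) (suc k) = begin
  suc (suc k) * (suc (suc n) C suc (suc k))
    ≡⟨ cong (suc (suc k) *_) (nCk+nC[k+1]≡[n+1]C[k+1] (suc n) (suc k)) ⟨
  suc (suc k) * (x + (suc n C suc (suc k)))
    ≡⟨ split k x (suc n C suc (suc k)) ⟩
  x + suc k * x + suc (suc k) * (suc n C suc (suc k))
    ≡⟨ cong₂ (λ a b → x + a + b) (C-absorb n k) (C-absorb n (suc k)) ⟩
  x + suc n * (n C k) + suc n * (n C suc k)
    ≡⟨ join n x (n C k) (n C suc k) ⟩
  x + suc n * ((n C k) + (n C suc k))
    ≡⟨ cong (λ a → x + suc n * a) (nCk+nC[k+1]≡[n+1]C[k+1] n k) ⟩
  suc (suc n) * x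
    ∎
  where
  x = suc n C suc k
  split : ∀ k x y → suc (suc k) * (x + y) ≡ x + suc k * x + suc (suc k) * y
  split = solve-∀
  join : ∀ n x a b → x + suc n * a + suc n * b ≡ x + suc n * (a + b)
  join = solve-∀

-- This is (n + 1 − k) C(n+1, k) = (n + 1) C(n, k), with no subtraction.
C-lower : ∀ n k → suc n * (n C k) + k * (suc n C k) ≡ suc n * (suc n C k)
C-lower n zero    = ℕₚ.+-identityʳ _
C-lower n (suc k) = begin
  suc n * (n C suc k) + suc k * (suc n C suc k)  ≡⟨ cong (λ x → suc n * (n C suc k) + x) (C-absorb n k) ⟩
  suc n * (n C suc k) + suc n * (n C k)          ≡⟨ join n (n C suc k) (n C k) ⟩
  suc n * ((n C k) + (n C suc k))                ≡⟨ cong (suc n *_) (nCk+nC[k+1]≡[n+1]C[k+1] n k) ⟩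
  suc n * (suc n C suc k)                        ∎
  where
  join : ∀ n a b → suc n * a + suc n * b ≡ suc n * (b + a)
  join = solve-∀

-- The recurrence for the counts and its solution

-- Abstracting from e keeps it from unfolding to a computation of deg (B m).
module DegreeSequence
  (f : ℕ → ℕ)
  (f-one  : f 1 ≡ 0)
  (f-even : ∀ h → f (2 * suc h) ≡ suc (f (suc h)))
  (f-odd  : ∀ h → f (suc (2 * suc h)) ≡ f (suc h) ⊔ f (suc (suc h)))
  where

  -- In each pair of neighbours one index is even, with value 1 + f(m), and the other is odd, with
  -- the maximum of f(m) and an adjacent value. The two bounds are proved together because the even
  -- and the odd step draw on opposite ones.
  f-adjacent : ∀ n → f (suc n) ≤ suc (f (suc (suc n))) × f (suc (suc n)) ≤ suc (f (suc n))
  f-adjacent = binaryInduction (λ m → f m ≤ suc (f (suc m)) × f (suc m) ≤ suc (f m))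
    (ℕₚ.≤-trans (ℕₚ.≤-reflexive f-one) z≤n , ℕₚ.≤-reflexive (f-even 0)) evenStep oddStep
    where
    evenStep : ∀ h → f (suc h) ≤ suc (f (suc (suc h))) × f (suc (suc h)) ≤ suc (f (suc h)) →
      f (2 * suc h) ≤ suc (f (suc (2 * suc h))) × f (suc (2 * suc h)) ≤ suc (f (2 * suc h))
    evenStep h (_ , b≤1+a) rewrite f-even h | f-odd h =
      s≤s (ℕₚ.m≤m⊔n _ _) , ℕₚ.⊔-lub (ℕₚ.m≤n⇒m≤1+n (ℕₚ.n≤1+n _)) (ℕₚ.m≤n⇒m≤1+n b≤1+a)

    oddStep : ∀ h → f (suc h) ≤ suc (f (suc (suc h))) × f (suc (suc h)) ≤ suc (f (suc h)) →
      f (suc (suc h)) ≤ suc (f (suc (suc (suc h)))) × f (suc (suc (suc h))) ≤ suc (f (suc (suc h))) →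
      f (suc (2 * suc h)) ≤ suc (f (suc (suc (2 * suc h))))
        × f (suc (suc (2 * suc h))) ≤ suc (f (suc (2 * suc h)))
    oddStep h (a≤1+b , _) _
      rewrite sym (ℕₚ.*-suc 2 (suc h)) | f-even (suc h) | f-odd h =
      ℕₚ.⊔-lub (ℕₚ.m≤n⇒m≤1+n a≤1+b) (ℕₚ.m≤n⇒m≤1+n (ℕₚ.n≤1+n _)) , s≤s (ℕₚ.m≤n⊔m (f (suc h)) _)

  -- The halves are 2m and 2m + 1; adjacency makes f(2m) = f(m) + 1 the larger value.
  f[4m+1] : ∀ h → f (suc (2 * (2 * suc h))) ≡ suc (f (suc h))
  f[4m+1] h = begin
    f (suc (2 * (2 * suc h)))                        ≡⟨ f-odd (h + suc (h + 0)) ⟩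
    f (2 * suc h) ⊔ f (suc (2 * suc h))              ≡⟨ cong₂ _⊔_ (f-even h) (f-odd h) ⟩
    suc (f (suc h)) ⊔ (f (suc h) ⊔ f (suc (suc h)))  ≡⟨ ℕₚ.m≥n⇒m⊔n≡m (ℕₚ.⊔-lub (ℕₚ.n≤1+n _) (proj₂ (f-adjacent h))) ⟩
    suc (f (suc h))                                  ∎

  -- Mirror image of the case 4m + 1: here the larger value comes from the half 2m + 2.
  f[4m+3] : ∀ h → f (suc (2 * suc (2 * suc h))) ≡ suc (f (suc (suc h)))
  f[4m+3] h = begin
    f (suc (2 * suc (2 * suc h)))
      ≡⟨ f-odd (2 * suc h) ⟩
    f (suc (2 * suc h)) ⊔ f (suc (suc (2 * suc h)))
      ≡⟨ cong₂ _⊔_ (f-odd h) (trans (cong f (sym (ℕₚ.*-suc 2 (suc h)))) (f-even (suc h))) ⟩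
    (f (suc h) ⊔ f (suc (suc h))) ⊔ suc (f (suc (suc h)))
      ≡⟨ ℕₚ.m≤n⇒m⊔n≡n (ℕₚ.⊔-lub (proj₁ (f-adjacent h)) (ℕₚ.n≤1+n _)) ⟩
    suc (f (suc (suc h)))
      ∎

  f[3]≡1 : f 3 ≡ 1
  f[3]≡1 = trans (f-odd 0) (cong₂ _⊔_ f-one (trans (f-even 0) (cong suc f-one)))

  f[2^n]≡n : ∀ n → f (2 ^ n) ≡ n
  f[2^n]≡n zero = f-one
  f[2^n]≡n (suc n) with 2 ^ n | ℕₚ.m^n>0 2 n | f[2^n]≡n n
  -- Positivity of the power excludes zero, so the power can be exposed as a successor, the form
  -- that `f-even` expects.
  ... | suc h | _ | eq = trans (f-even h) (cong suc eq)

  -- With m = h + 1, the indices 4m + 1 to 4m + 4 all have successor values. A block therefore adds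
  -- nothing at degree 0 and lowers the degree by one elsewhere.
  count-block : ∀ i h → count f i (4 * suc (suc h)) ≡
    count f i (4 * suc h) + δ (suc (f (suc h))) i + δ (suc (f (suc (2 * suc h)))) i
      + δ (suc (f (suc (suc h)))) i + δ (suc (f (2 * suc (suc h)))) i
  count-block i h = begin
    count f i (4 * suc (suc h))
      ≡⟨ cong (count f i) (ℕₚ.*-suc 4 (suc h)) ⟩
    count f i (4 + 4 * suc h)
      ≡⟨ cong₂ _+_ (cong₂ _+_ (cong₂ _+_ (cong₂ _+_ refl
           (δ≡ (eq₁ h) (f[4m+1] h)))
           (δ≡ (eq₂ h) (f-even (2 * suc h))))
           (δ≡ (eq₃ h) (f[4m+3] h)))
           (δ≡ (eq₄ h) (f-even (suc h + suc (suc (h + 0))))) ⟩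
    count f i (4 * suc h) + δ (suc (f (suc h))) i + δ (suc (f (suc (2 * suc h)))) i
      + δ (suc (f (suc (suc h)))) i + δ (suc (f (2 * suc (suc h)))) i
      ∎
    where
    δ≡ : ∀ {m m′ b} → m ≡ m′ → f m′ ≡ b → δ (f m) i ≡ δ b i
    δ≡ refl fm≡b = cong (λ a → δ a i) fm≡b
    eq₁ : ∀ h → 1 + 4 * suc h ≡ suc (2 * (2 * suc h))
    eq₁ = solve-∀
    eq₂ : ∀ h → 2 + 4 * suc h ≡ 2 * suc (2 * suc h)
    eq₂ = solve-∀
    eq₃ : ∀ h → 3 + 4 * suc h ≡ suc (2 * suc (2 * suc h))
    eq₃ = solve-∀
    eq₄ : ∀ h → 4 + 4 * suc h ≡ 2 * (2 * suc (suc h))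
    eq₄ = solve-∀

  count-0-4m : ∀ h → count f 0 (4 * suc h) ≡ 1
  count-0-4m zero rewrite f-one | f-even 0 | f[3]≡1 | f-even 1 = refl
  count-0-4m (suc h) = begin
    count f 0 (4 * suc (suc h))        ≡⟨ count-block 0 h ⟩
    count f 0 (4 * suc h) + 0 + 0 + 0 + 0 ≡⟨ drop0s (count f 0 (4 * suc h)) ⟩
    count f 0 (4 * suc h)              ≡⟨ count-0-4m h ⟩
    1                                  ∎
    where
    drop0s : ∀ a → a + 0 + 0 + 0 + 0 ≡ a
    drop0s = solve-∀

  -- The three summands come from the even m, from m = 4l + 3 and from m = 4l + 1 > 1.
  count-suc-4m : ∀ i h → count f (suc i) (4 * suc h) ≡
    count f i (2 * suc h) + count f i (suc h) + count f i h
  count-suc-4m i zero rewrite f-one | f-even 0 | f[3]≡1 | f-even 1 | f-even 0 | f-one =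
    rearrange (δ 0 i) (δ 1 i)
    where
    rearrange : ∀ a b → a + a + b ≡ a + b + a + 0
    rearrange = solve-∀
  count-suc-4m i (suc h) = begin
    count f (suc i) (4 * suc (suc h))
      ≡⟨ count-block (suc i) h ⟩
    count f (suc i) (4 * suc h) + δ a i + δ b i + δ c i + δ d i
      ≡⟨ cong (λ x → x + δ a i + δ b i + δ c i + δ d i) (count-suc-4m i h) ⟩
    count f i (2 * suc h) + count f i (suc h) + count f i h + δ a i + δ b i + δ c i + δ d i
      ≡⟨ rearrange (count f i (2 * suc h)) (count f i (suc h)) (count f i h) (δ a i) (δ b i) (δ c i) (δ d i) ⟩
    (count f i (2 * suc h) + δ b i + δ d i) + (count f i (suc h) + δ c i) + (count f i h + δ a i)
      ≡⟨ cong (λ x → x + count f i (suc (suc h)) + count f i (suc h)) double ⟩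
    count f i (2 * suc (suc h)) + count f i (suc (suc h)) + count f i (suc h)
      ∎
    where
    a = f (suc h)
    b = f (suc (2 * suc h))
    c = f (suc (suc h))
    d = f (2 * suc (suc h))
    rearrange : ∀ x y z a b c d → x + y + z + a + b + c + d ≡ (x + b + d) + (y + c) + (z + a)
    rearrange = solve-∀
    double : count f i (2 * suc h) + δ b i + δ d i ≡ count f i (2 * suc (suc h))
    double = trans (cong (λ m → count f i (2 * suc h) + δ b i + δ (f m) i) (ℕₚ.*-suc 2 (suc h)))
                   (cong (count f i) (sym (ℕₚ.*-suc 2 (suc h))))

  4*2^n : ∀ n → 2 ^ suc (suc n) ≡ 4 * 2 ^ n
  4*2^n n = sym (ℕₚ.*-assoc 2 2 (2 ^ n))

  count-0-2^n : ∀ n → count f 0 (2 ^ n) ≡ 1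
  count-0-2^n zero rewrite f-one = refl
  count-0-2^n (suc zero) rewrite f-one | f-even 0 = refl
  count-0-2^n (suc (suc n)) rewrite 4*2^n n with 2 ^ n | ℕₚ.m^n>0 2 n
  ... | suc h | _ = count-0-4m h

  -- δ n i corrects for m = 2ⁿ: e(4m+1) = e(m) + 1, but 4m + 1 lies beyond 2ⁿ⁺².
  count-suc-2^n : ∀ i n → count f (suc i) (2 ^ suc (suc n)) + δ n i ≡
                  count f i (2 ^ suc n) + 2 * count f i (2 ^ n)
  count-suc-2^n i n rewrite 4*2^n n with 2 ^ n | ℕₚ.m^n>0 2 n | f[2^n]≡n n
  ... | suc h | _ | eq = begin
    count f (suc i) (4 * suc h) + δ n i
      ≡⟨ cong (_+ δ n i) (count-suc-4m i h) ⟩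
    count f i (2 * suc h) + count f i (suc h) + count f i h + δ n i
      ≡⟨ rearrange (count f i (2 * suc h)) (count f i (suc h)) (count f i h) (δ n i) ⟩
    count f i (2 * suc h) + (count f i (suc h) + (count f i h + δ n i))
      ≡⟨ cong (λ a → count f i (2 * suc h) + (count f i (suc h) + (count f i h + δ a i))) eq ⟨
    count f i (2 * suc h) + (count f i (suc h) + count f i (suc h))
      ≡⟨ cong (λ x → count f i (2 * suc h) + (count f i (suc h) + x)) (ℕₚ.+-identityʳ (count f i (suc h))) ⟨
    count f i (2 * suc h) + 2 * count f i (suc h)
      ∎
    where
    rearrange : ∀ x y z d → x + y + z + d ≡ x + (y + (z + d))
    rearrange = solve-∀

  -- Both terms on the right of the recurrence lie above the diagonal again. A sum of naturals equal
  -- to 0 has zero summands, so the correction term needs no evaluation.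
  count-2^n-≡0 : ∀ i n → n < i → count f i (2 ^ n) ≡ 0
  count-2^n-≡0 (suc i) zero _ rewrite f-one = refl
  count-2^n-≡0 (suc zero) (suc zero) (s≤s ())
  count-2^n-≡0 (suc (suc i)) (suc zero) _ rewrite f-one | f-even 0 | f-one = refl
  count-2^n-≡0 (suc i) (suc (suc n)) (s≤s n+1<i) = ℕₚ.m+n≡0⇒m≡0 _ (begin
    count f (suc i) (2 ^ suc (suc n)) + δ n i      ≡⟨ count-suc-2^n i n ⟩
    count f i (2 ^ suc n) + 2 * count f i (2 ^ n)  ≡⟨ cong₂ (λ x y → x + 2 * y) (count-2^n-≡0 i (suc n) n+1<i) (count-2^n-≡0 i n (ℕₚ.<-trans (ℕₚ.n<1+n n) n+1<i)) ⟩
    0                                              ∎)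

  -- On the diagonal the correction δ and the doubled term both vanish, so the recurrence copies the
  -- previous diagonal entry.
  count-diagonal : ∀ n → count f n (2 ^ n) ≡ 1
  count-diagonal zero = count-0-2^n 0
  count-diagonal (suc zero) rewrite f-one | f-even 0 | f-one = refl
  count-diagonal (suc (suc n)) = begin
    count f (2 + n) (2 ^ (2 + n))                                  ≡⟨ ℕₚ.+-identityʳ _ ⟨
    count f (2 + n) (2 ^ (2 + n)) + 0                              ≡⟨ cong (λ x → count f (2 + n) (2 ^ (2 + n)) + x) (δ-≢ (ℕₚ.<⇒≢ (ℕₚ.n<1+n n))) ⟨
    count f (2 + n) (2 ^ (2 + n)) + δ n (suc n)                    ≡⟨ count-suc-2^n (suc n) n ⟩
    count f (suc n) (2 ^ suc n) + 2 * count f (suc n) (2 ^ n)      ≡⟨ cong₂ (λ x y → x + 2 * y) (count-diagonal (suc n)) (count-2^n-≡0 (suc n) n (ℕₚ.n<1+n n)) ⟩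
    1                                                              ∎

  -- Writing n = i + k + 1 avoids subtraction. Both summands of the formula obey Pascal-type rules
  -- matching the recurrence. The case k = 0 is separate: it involves the diagonal value, which the
  -- formula does not cover, and the correction δ is 1 there.
  count-formula : ∀ i k → count f i (2 ^ (i + suc k)) ≡ partialSum i (suc k) + 2 ^ k * (i C suc k)
  count-formula zero k = begin
    count f 0 (2 ^ suc k)                      ≡⟨ count-0-2^n (suc k) ⟩
    1                                          ≡⟨ one ⟨
    partialSum 0 (suc k) + 2 ^ k * (0 C suc k) ∎
    where
    one : partialSum 0 (suc k) + 2 ^ k * (0 C suc k) ≡ 1
    one rewrite partialSum-full {0} {suc k} (s≤s z≤n) | k>n⇒nCk≡0 {0} {suc k} (s≤s z≤n) | ℕₚ.*-zeroʳ (2 ^ k) = refl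
  count-formula (suc i) zero = ℕₚ.+-cancelʳ-≡ 1 _ _ (begin
    count f (suc i) (2 ^ (suc i + 1)) + 1
      ≡⟨ cong₂ (λ m x → count f (suc i) (2 ^ m) + x) (cong suc (ℕₚ.+-comm i 1)) (sym (δ-refl i)) ⟩
    count f (suc i) (2 ^ suc (suc i)) + δ i i
      ≡⟨ count-suc-2^n i i ⟩
    count f i (2 ^ suc i) + 2 * count f i (2 ^ i)
      ≡⟨ cong₂ (λ x y → x + 2 * y) (trans (cong (λ m → count f i (2 ^ m)) (ℕₚ.+-comm 1 i)) (count-formula i 0)) (count-diagonal i) ⟩
    1 + 1 * (i C 1) + 2
      ≡⟨ rearrange (i C 1) ⟩
    1 + 1 * (1 + i C 1) + 1
      ≡⟨ cong (λ x → 1 + 1 * x + 1) (nCk+nC[k+1]≡[n+1]C[k+1] i 0) ⟩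
    1 + 1 * (suc i C 1) + 1
      ∎)
    where
    rearrange : ∀ c → 1 + 1 * c + 2 ≡ 1 + 1 * (1 + c) + 1
    rearrange = solve-∀
  count-formula (suc i) (suc k) = begin
    count f (suc i) (2 ^ (suc i + suc (suc k)))
      ≡⟨ ℕₚ.+-identityʳ _ ⟨
    count f (suc i) (2 ^ (suc i + suc (suc k))) + 0
      ≡⟨ cong₂ (λ m x → count f (suc i) (2 ^ m) + x) (cong suc (ℕₚ.+-suc i (suc k)))
               (sym (δ-≢ (λ eq → ℕₚ.m+1+n≢m i eq))) ⟩
    count f (suc i) (2 ^ suc (suc (i + suc k))) + δ (i + suc k) i
      ≡⟨ count-suc-2^n i (i + suc k) ⟩
    count f i (2 ^ suc (i + suc k)) + 2 * count f i (2 ^ (i + suc k))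
      ≡⟨ cong₂ (λ x y → x + 2 * y)
           (trans (cong (λ m → count f i (2 ^ m)) (sym (ℕₚ.+-suc i (suc k)))) (count-formula i (suc k)))
           (count-formula i k) ⟩
    (s + 2 * 2 ^ k * d) + 2 * (partialSum i (suc k) + 2 ^ k * c)
      ≡⟨ rearrange s (partialSum i (suc k)) (2 ^ k) c d ⟩
    (s + 2 * partialSum i (suc k)) + 2 * 2 ^ k * (c + d)
      ≡⟨ cong₂ (λ x y → x + 2 * 2 ^ k * y) (sym (partialSum-pascal i (suc k))) (nCk+nC[k+1]≡[n+1]C[k+1] i (suc k)) ⟩
    partialSum (suc i) (suc (suc k)) + 2 ^ suc k * (suc i C suc (suc k))
      ∎
    where
    s = partialSum i (suc (suc k))
    c = i C suc k
    d = i C suc (suc k)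
    rearrange : ∀ s t p c d → (s + 2 * p * d) + 2 * (t + p * c) ≡ (s + 2 * t) + 2 * p * (c + d)
    rearrange = solve-∀

-- Coefficients of H

coeff-monomial : ∀ c a i → coeff (monomial (+ c) a) i ≡ + (c * δ a i)
coeff-monomial c zero    zero    = cong +_ (sym (ℕₚ.*-identityʳ c))
coeff-monomial c zero    (suc i) = cong +_ (sym (ℕₚ.*-zeroʳ c))
coeff-monomial c (suc a) zero    = cong +_ (sym (ℕₚ.*-zeroʳ c))
coeff-monomial c (suc a) (suc i) = coeff-monomial c a i

-- `sumₚ` folds from the right, whereas `count` grows at the end; this reconciles the two
-- directions.
coeff-sumₚ-∷ʳ : ∀ (F : ℕ → Poly) xs x i →
  coeff (sumₚ (map F (xs ∷ʳ x))) i ≡ coeff (sumₚ (map F xs)) i ℤ.+ coeff (F x) i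
coeff-sumₚ-∷ʳ F [] x i = begin
  coeff (F x +ₚ []) i  ≡⟨ coeff-+ₚ (F x) [] i ⟩
  coeff (F x) i ℤ.+ 0ℤ ≡⟨ ℤₚ.+-comm (coeff (F x) i) 0ℤ ⟩
  0ℤ ℤ.+ coeff (F x) i ∎
coeff-sumₚ-∷ʳ F (y ∷ xs) x i = begin
  coeff (F y +ₚ sumₚ (map F (xs ∷ʳ x))) i
    ≡⟨ coeff-+ₚ (F y) _ i ⟩
  coeff (F y) i ℤ.+ coeff (sumₚ (map F (xs ∷ʳ x))) i
    ≡⟨ cong (λ z → coeff (F y) i ℤ.+ z) (coeff-sumₚ-∷ʳ F xs x i) ⟩
  coeff (F y) i ℤ.+ (coeff (sumₚ (map F xs)) i ℤ.+ coeff (F x) i)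
    ≡⟨ ℤₚ.+-assoc (coeff (F y) i) _ _ ⟨
  coeff (F y) i ℤ.+ coeff (sumₚ (map F xs)) i ℤ.+ coeff (F x) i
    ≡⟨ cong (λ z → z ℤ.+ coeff (F x) i) (coeff-+ₚ (F y) _ i) ⟨
  coeff (F y +ₚ sumₚ (map F xs)) i ℤ.+ coeff (F x) i
    ∎

coeff-generating : ∀ f i m → coeff (sumₚ (map (λ k → monomial 1ℤ (f k)) (range₁ m))) i ≡ + count f i m
coeff-generating f i zero    = refl
coeff-generating f i (suc m) = begin
  coeff (sumₚ (map F (range₁ (suc m)))) i
    ≡⟨ cong (λ xs → coeff (sumₚ (map F xs)) i) (range₁-∷ʳ m) ⟩
  coeff (sumₚ (map F (range₁ m ∷ʳ suc m))) i
    ≡⟨ coeff-sumₚ-∷ʳ F (range₁ m) (suc m) i ⟩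
  coeff (sumₚ (map F (range₁ m))) i ℤ.+ coeff (F (suc m)) i
    ≡⟨ cong₂ ℤ._+_ (coeff-generating f i m) (coeff-monomial 1 (f (suc m)) i) ⟩
  + (count f i m + 1 * δ (f (suc m)) i)
    ≡⟨ cong (λ x → + (count f i m + x)) (ℕₚ.*-identityˡ _) ⟩
  + count f i (suc m)
    ∎
  where F = λ k → monomial 1ℤ (f k)

coeff-upTo-suc : ∀ (g : ℕ → ℕ) m i → coeff (sumₚ (map (λ j → monomial (+ g j) j) (upTo (suc m)))) i
  ≡ coeff (sumₚ (map (λ j → monomial (+ g j) j) (upTo m))) i ℤ.+ + (g m * δ m i)
coeff-upTo-suc g m i = begin
  coeff (sumₚ (map F (upTo (suc m)))) i                 ≡⟨ cong (λ xs → coeff (sumₚ (map F xs)) i) (upTo-∷ʳ m) ⟨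
  coeff (sumₚ (map F (upTo m ∷ʳ m))) i                  ≡⟨ coeff-sumₚ-∷ʳ F (upTo m) m i ⟩
  coeff (sumₚ (map F (upTo m))) i ℤ.+ coeff (F m) i     ≡⟨ cong (λ z → coeff (sumₚ (map F (upTo m))) i ℤ.+ z) (coeff-monomial (g m) m i) ⟩
  coeff (sumₚ (map F (upTo m))) i ℤ.+ + (g m * δ m i)   ∎
  where F = λ j → monomial (+ g j) j

coeff-upTo-≥ : ∀ (g : ℕ → ℕ) m i → m ≤ i → coeff (sumₚ (map (λ j → monomial (+ g j) j) (upTo m))) i ≡ 0ℤ
coeff-upTo-≥ g zero    i _   = refl
coeff-upTo-≥ g (suc m) i m<i
  rewrite coeff-upTo-suc g m i | coeff-upTo-≥ g m i (ℕₚ.<⇒≤ m<i) | δ-≢ (ℕₚ.<⇒≢ m<i) | ℕₚ.*-zeroʳ (g m) = refl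

coeff-upTo-< : ∀ (g : ℕ → ℕ) m i → i < m → coeff (sumₚ (map (λ j → monomial (+ g j) j) (upTo m))) i ≡ + g i
coeff-upTo-< g (suc m) i i<1+m with ℕₚ.m≤n⇒m<n∨m≡n (s≤s⁻¹ i<1+m)
... | inj₁ i<m
  rewrite coeff-upTo-suc g m i | coeff-upTo-< g m i i<m | δ-≢ (ℕₚ.>⇒≢ i<m) | ℕₚ.*-zeroʳ (g m)
        | ℕₚ.+-identityʳ (g i) = refl
... | inj₂ refl
  rewrite coeff-upTo-suc g m m | coeff-upTo-≥ g m m ℕₚ.≤-refl | δ-refl m | ℕₚ.*-identityʳ (g m) = refl

-- Rational arithmetic

-- Entry to unnormalised rationals, where equality is cross-multiplication and no gcd has to be
-- computed.
toℚᵘ-/1 : ∀ z → ℚ.toℚᵘ (z ℚ./ 1) ℚᵘ.≃ ℚᵘ.mkℚᵘ z 0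
toℚᵘ-/1 z = ℚₚ.toℚᵘ-fromℚᵘ (ℚᵘ.mkℚᵘ z 0)

/1-homo-* : ∀ x y → (x ℤ.* y) ℚ./ 1 ≡ (x ℚ./ 1) ℚ.* (y ℚ./ 1)
/1-homo-* x y = ℚₚ.toℚᵘ-injective (ℚᵘₚ.≃-trans (toℚᵘ-/1 (x ℤ.* y)) (ℚᵘₚ.≃-sym
  (ℚᵘₚ.≃-trans (ℚₚ.toℚᵘ-homo-* (x ℚ./ 1) (y ℚ./ 1)) (ℚᵘₚ.*-cong (toℚᵘ-/1 x) (toℚᵘ-/1 y)))))

/1-homo-+ : ∀ x y → (x ℤ.+ y) ℚ./ 1 ≡ (x ℚ./ 1) ℚ.+ (y ℚ./ 1)
/1-homo-+ x y = ℚₚ.toℚᵘ-injective (ℚᵘₚ.≃-trans (toℚᵘ-/1 (x ℤ.+ y)) (ℚᵘₚ.≃-sym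
  (ℚᵘₚ.≃-trans (ℚₚ.toℚᵘ-homo-+ (x ℚ./ 1) (y ℚ./ 1))
  (ℚᵘₚ.≃-trans (ℚᵘₚ.+-cong (toℚᵘ-/1 x) (toℚᵘ-/1 y))
               (ℚᵘ.*≡* (cong (ℤ._* 1ℤ) (cong₂ ℤ._+_ (ℤₚ.*-identityʳ x) (ℤₚ.*-identityʳ y))))))))

fromℕ-homo-+ : ∀ m n → fromℕ (m + n) ≡ fromℕ m ℚ.+ fromℕ n
fromℕ-homo-+ m n = /1-homo-+ (+ m) (+ n)

fromℕ-homo-* : ∀ m n → fromℕ (m * n) ≡ fromℕ m ℚ.* fromℕ n
fromℕ-homo-* m n = trans (cong (ℚ._/ 1) (ℤₚ.pos-* m n)) (/1-homo-* (+ m) (+ n))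

/-*-cancel : ∀ z d .{{_ : NonZero d}} → (z ℚ./ d) ℚ.* fromℕ d ≡ z ℚ./ 1
/-*-cancel z d@(suc d-1) = ℚₚ.toℚᵘ-injective
  (ℚᵘₚ.≃-trans (ℚₚ.toℚᵘ-homo-* (z ℚ./ d) (fromℕ d))
  (ℚᵘₚ.≃-trans (ℚᵘₚ.*-cong (ℚₚ.toℚᵘ-fromℚᵘ (ℚᵘ.mkℚᵘ z d-1)) (toℚᵘ-/1 (+ d)))
  (ℚᵘₚ.≃-trans (ℚᵘ.*≡* cross) (ℚᵘₚ.≃-sym (toℚᵘ-/1 z)))))
  where
  cross : (z ℤ.* + d) ℤ.* 1ℤ ≡ z ℤ.* (+ (d * 1))
  cross = trans (ℤₚ.*-identityʳ _) (cong (λ x → z ℤ.* + x) (sym (ℕₚ.*-identityʳ d)))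

fromℕ-cancelˡ : ∀ d .{{_ : NonZero d}} {x y} → fromℕ d ℚ.* x ≡ fromℕ d ℚ.* y → x ≡ y
fromℕ-cancelˡ d {x} {y} eq = trans (sym (inverse x)) (trans (cong (λ z → (1ℤ ℚ./ d) ℚ.* z) eq) (inverse y))
  where
  inverse : ∀ x → (1ℤ ℚ./ d) ℚ.* (fromℕ d ℚ.* x) ≡ x
  inverse x = trans (sym (ℚₚ.*-assoc (1ℤ ℚ./ d) (fromℕ d) x))
    (trans (cong (ℚ._* x) (/-*-cancel 1ℤ d)) (ℚₚ.*-identityˡ x))

/-exact : ∀ d .{{_ : NonZero d}} m → (+ (d * m)) ℚ./ d ≡ fromℕ m
/-exact d m = fromℕ-cancelˡ d (begin
  fromℕ d ℚ.* ((+ (d * m)) ℚ./ d)  ≡⟨ ℚₚ.*-comm (fromℕ d) _ ⟩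
  ((+ (d * m)) ℚ./ d) ℚ.* fromℕ d  ≡⟨ /-*-cancel (+ (d * m)) d ⟩
  fromℕ (d * m)                    ≡⟨ fromℕ-homo-* d m ⟩
  fromℕ d ℚ.* fromℕ m              ∎)

-- The middle range

open +-*-Solver using (solve; con; _:=_; _:+_; _:*_; _:-_; :-_)

-- With j = a + 1 and n = j + m this is (2n - 5j) C(j, m) = -j (C(j, m) + 2 C(a, m)), moved to one
-- sign so that it lives in ℕ.
summand-identity : ∀ a m →
  2 * (suc a + m) * (suc a C m) + suc a * ((suc a C m) + 2 * (a C m)) ≡ 5 * suc a * (suc a C m)
summand-identity a m = begin
  2 * (suc a + m) * c + suc a * (c + 2 * d)        ≡⟨ gather a m c d ⟩
  3 * (suc a * c) + 2 * (suc a * d + m * c)        ≡⟨ cong (λ x → 3 * (suc a * c) + 2 * x) (C-lower a m) ⟩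
  3 * (suc a * c) + 2 * (suc a * c)                ≡⟨ finish a c ⟩
  5 * suc a * c                                    ∎
  where
  c = suc a C m
  d = a C m
  gather : ∀ a m c d → 2 * (suc a + m) * c + suc a * (c + 2 * d) ≡ 3 * (suc a * c) + 2 * (suc a * d + m * c)
  gather = solve-∀
  finish : ∀ a c → 3 * (suc a * c) + 2 * (suc a * c) ≡ 5 * suc a * c
  finish = solve-∀

-- Multiplying by j as well clears the whole denominator j 6ʲ; `summand-identity` then supplies a
-- factor j to cancel.
6^j*summand : ∀ a m → fromℕ (6 ^ suc a) ℚ.* summand (suc a + m) (suc a) ≡
              ℚ.- fromℕ ((suc a C m) + 2 * (a C m))
6^j*summand a m = trans
  (cong (λ k → fromℕ s ℚ.* (q ℚ.* fromℕ (j C k))) (ℕₚ.m+n∸m≡n a m))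
  (fromℕ-cancelˡ j (begin
  fromℕ j ℚ.* (fromℕ s ℚ.* (q ℚ.* fromℕ c))
    ≡⟨ solve 4 (λ j s q c → j :* (s :* (q :* c)) := (q :* (j :* s)) :* c) refl (fromℕ j) (fromℕ s) q (fromℕ c) ⟩
  (q ℚ.* (fromℕ j ℚ.* fromℕ s)) ℚ.* fromℕ c
    ≡⟨ cong (λ x → (q ℚ.* x) ℚ.* fromℕ c) (fromℕ-homo-* j s) ⟨
  (q ℚ.* fromℕ (j * s)) ℚ.* fromℕ c
    ≡⟨ cong (ℚ._* fromℕ c) (/-*-cancel z (j * s) {{j6ʲ≢0 j}}) ⟩
  (z ℚ./ 1) ℚ.* fromℕ c
    ≡⟨ cong (ℚ._* fromℕ c) z/1 ⟩
  (fromℕ (2 * (j + m)) ℚ.- fromℕ (5 * j)) ℚ.* fromℕ c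
    ≡⟨ solve 3 (λ x y c → (x :- y) :* c := x :* c :- y :* c) refl (fromℕ (2 * (j + m))) (fromℕ (5 * j)) (fromℕ c) ⟩
  fromℕ (2 * (j + m)) ℚ.* fromℕ c ℚ.- fromℕ (5 * j) ℚ.* fromℕ c
    ≡⟨ cong (λ x → fromℕ (2 * (j + m)) ℚ.* fromℕ c ℚ.- x) identity ⟨
  fromℕ (2 * (j + m)) ℚ.* fromℕ c ℚ.- (fromℕ (2 * (j + m)) ℚ.* fromℕ c ℚ.+ fromℕ j ℚ.* fromℕ w)
    ≡⟨ solve 3 (λ x j w → x :- (x :+ j :* w) := j :* (:- w)) refl (fromℕ (2 * (j + m)) ℚ.* fromℕ c) (fromℕ j) (fromℕ w) ⟩
  fromℕ j ℚ.* (ℚ.- fromℕ w)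
    ∎))
  where
  j = suc a
  s = 6 ^ suc a
  c = suc a C m
  w = (suc a C m) + 2 * (a C m)
  z = + (2 * (suc a + m)) ℤ.- + (5 * suc a)
  q = (z ℚ./ (j * s)) {{j6ʲ≢0 j}}

  z/1 : z ℚ./ 1 ≡ fromℕ (2 * (j + m)) ℚ.- fromℕ (5 * j)
  z/1 = /1-homo-+ (+ (2 * (j + m))) (ℤ.- + (5 * j))

  identity : fromℕ (2 * (j + m)) ℚ.* fromℕ c ℚ.+ fromℕ j ℚ.* fromℕ w ≡ fromℕ (5 * j) ℚ.* fromℕ c
  identity = begin
    fromℕ (2 * (j + m)) ℚ.* fromℕ c ℚ.+ fromℕ j ℚ.* fromℕ w
      ≡⟨ cong₂ ℚ._+_ (fromℕ-homo-* (2 * (j + m)) c) (fromℕ-homo-* j w) ⟨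
    fromℕ (2 * (j + m) * c) ℚ.+ fromℕ (j * w)
      ≡⟨ fromℕ-homo-+ (2 * (j + m) * c) (j * w) ⟨
    fromℕ (2 * (j + m) * c + j * w)
      ≡⟨ cong fromℕ (summand-identity a m) ⟩
    fromℕ (5 * j * c)
      ≡⟨ fromℕ-homo-* (5 * j) c ⟩
    fromℕ (5 * j) ℚ.* fromℕ c
      ∎

^-distribʳ-* : ∀ x y n → (x * y) ^ n ≡ x ^ n * y ^ n
^-distribʳ-* x y zero    = refl
^-distribʳ-* x y (suc n) = trans (cong (x * y *_) (^-distribʳ-* x y n)) (interchange x y (x ^ n) (y ^ n))
  where
  interchange : ∀ x y u v → x * y * (u * v) ≡ x * u * (y * v)
  interchange = solve-∀

-- One telescoping step. Since 3ʲ 2ⁿ = 2ᵐ 6ʲ for j = a + 1 and n = j + m, the new summand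
-- contributes exactly the negative of the term 2ᵐ (C(j, m) + 2 C(a, m)) in `partialSum-shift`.
scaled-step : ∀ a m x → let n = suc a + m in
  fromℕ (3 ^ a) ℚ.* (1ℚ ℚ.+ fromℕ (2 ^ n) ℚ.* x) ≡ fromℕ (partialSum a (suc m)) →
  fromℕ (3 ^ suc a) ℚ.* (1ℚ ℚ.+ fromℕ (2 ^ n) ℚ.* (x ℚ.+ summand n (suc a))) ≡ fromℕ (partialSum (suc a) m)
scaled-step a m x hyp = begin
  fromℕ (3 ^ suc a) ℚ.* (1ℚ ℚ.+ N ℚ.* (x ℚ.+ f))
    ≡⟨ cong (ℚ._* (1ℚ ℚ.+ N ℚ.* (x ℚ.+ f))) (fromℕ-homo-* 3 (3 ^ a)) ⟩
  (t ℚ.* A) ℚ.* (1ℚ ℚ.+ N ℚ.* (x ℚ.+ f))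
    ≡⟨ solve 5 (λ t A N x f → (t :* A) :* (con 1ℚ :+ N :* (x :+ f))
         := t :* (A :* (con 1ℚ :+ N :* x)) :+ ((t :* A) :* N) :* f) refl t A N x f ⟩
  t ℚ.* (A ℚ.* (1ℚ ℚ.+ N ℚ.* x)) ℚ.+ ((t ℚ.* A) ℚ.* N) ℚ.* f
    ≡⟨ cong₂ (λ u v → t ℚ.* u ℚ.+ v ℚ.* f) hyp powers ⟩
  t ℚ.* fromℕ (partialSum a (suc m)) ℚ.+ (M ℚ.* S) ℚ.* f
    ≡⟨ cong₂ ℚ._+_ shift (ℚₚ.*-assoc M S f) ⟩
  (R ℚ.+ M ℚ.* fromℕ w) ℚ.+ M ℚ.* (S ℚ.* f)
    ≡⟨ cong (λ v → (R ℚ.+ M ℚ.* fromℕ w) ℚ.+ M ℚ.* v) (6^j*summand a m) ⟩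
  (R ℚ.+ M ℚ.* fromℕ w) ℚ.+ M ℚ.* (ℚ.- fromℕ w)
    ≡⟨ solve 3 (λ R M w → (R :+ M :* w) :+ M :* (:- w) := R) refl R M (fromℕ w) ⟩
  R
    ∎
  where
  n = suc a + m
  t = fromℕ 3
  A = fromℕ (3 ^ a)
  N = fromℕ (2 ^ n)
  M = fromℕ (2 ^ m)
  S = fromℕ (6 ^ suc a)
  f = summand n (suc a)
  R = fromℕ (partialSum (suc a) m)
  w = (suc a C m) + 2 * (a C m)

  powersℕ : 3 ^ suc a * 2 ^ n ≡ 2 ^ m * 6 ^ suc a
  powersℕ = begin
    3 ^ suc a * 2 ^ n                ≡⟨ cong (3 ^ suc a *_) (ℕₚ.^-distribˡ-+-* 2 (suc a) m) ⟩
    3 ^ suc a * (2 ^ suc a * 2 ^ m)  ≡⟨ ℕₚ.*-assoc (3 ^ suc a) (2 ^ suc a) (2 ^ m) ⟨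
    3 ^ suc a * 2 ^ suc a * 2 ^ m    ≡⟨ cong (_* 2 ^ m) (^-distribʳ-* 3 2 (suc a)) ⟨
    6 ^ suc a * 2 ^ m                ≡⟨ ℕₚ.*-comm (6 ^ suc a) (2 ^ m) ⟩
    2 ^ m * 6 ^ suc a                ∎

  powers : (t ℚ.* A) ℚ.* N ≡ M ℚ.* S
  powers = begin
    (t ℚ.* A) ℚ.* N              ≡⟨ cong (ℚ._* N) (fromℕ-homo-* 3 (3 ^ a)) ⟨
    fromℕ (3 ^ suc a) ℚ.* N      ≡⟨ fromℕ-homo-* (3 ^ suc a) (2 ^ n) ⟨
    fromℕ (3 ^ suc a * 2 ^ n)    ≡⟨ cong fromℕ powersℕ ⟩
    fromℕ (2 ^ m * 6 ^ suc a)    ≡⟨ fromℕ-homo-* (2 ^ m) (6 ^ suc a) ⟩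
    M ℚ.* S                      ∎

  shift : t ℚ.* fromℕ (partialSum a (suc m)) ≡ R ℚ.+ M ℚ.* fromℕ w
  shift = begin
    t ℚ.* fromℕ (partialSum a (suc m))          ≡⟨ fromℕ-homo-* 3 (partialSum a (suc m)) ⟨
    fromℕ (3 * partialSum a (suc m))            ≡⟨ cong fromℕ (partialSum-shift a m) ⟨
    fromℕ (partialSum (suc a) m + 2 ^ m * w)    ≡⟨ fromℕ-homo-+ (partialSum (suc a) m) (2 ^ m * w) ⟩
    R ℚ.+ fromℕ (2 ^ m * w)                     ≡⟨ cong (λ v → R ℚ.+ v) (fromℕ-homo-* (2 ^ m) w) ⟩
    R ℚ.+ M ℚ.* fromℕ w                         ∎

-- `sumFrom` peels terms off the front, so the invariant speaks of the prefix sum `x` through index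
-- `a`. Starting at `suc a` makes the nonzero instance automatic.
sumFrom-invariant : (I : ℕ → ℚ → Set) (f : (j : ℕ) .{{_ : NonZero j}} → ℚ) (b : ℕ) →
  (∀ a x → a < b → I a x → I (suc a) (x ℚ.+ f (suc a))) →
  ∀ a len x → a + len ≤ b → I a x → I (a + len) (x ℚ.+ sumFrom (suc a) len f)
sumFrom-invariant I f b step a zero x _ Iax =
  subst₂ I (sym (ℕₚ.+-identityʳ a)) (sym (ℚₚ.+-identityʳ x)) Iax
sumFrom-invariant I f b step a (suc len) x a+len<b Iax =
  subst₂ I (sym (ℕₚ.+-suc a len)) (ℚₚ.+-assoc x (f (suc a)) (sumFrom (suc (suc a)) len f))
    (sumFrom-invariant I f b step (suc a) len (x ℚ.+ f (suc a)) 1+a+len≤b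
      (step a x (ℕₚ.≤-trans (s≤s (ℕₚ.m≤m+n a len)) 1+a+len≤b) Iax))
  where
  1+a+len≤b : suc a + len ≤ b
  1+a+len≤b = subst (_≤ b) (ℕₚ.+-suc a len) a+len<b

Scaled : ℕ → ℕ → ℚ → Set
Scaled n a x = fromℕ (3 ^ a) ℚ.* (1ℚ ℚ.+ fromℕ (2 ^ n) ℚ.* x) ≡ fromℕ (partialSum a (n ∸ a))

scaled-step-< : ∀ n a x → a < n → Scaled n a x → Scaled n (suc a) (x ℚ.+ summand n (suc a))
-- `at` abstracts `n`, so that n = a + 1 + m can be matched with `refl`.
scaled-step-< n a x a<n hyp = at n (n ∸ suc a) (sym (ℕₚ.m+[n∸m]≡n a<n))
  (trans hyp (cong (λ k → fromℕ (partialSum a k)) (ℕₚ.+-∸-assoc 1 a<n)))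
  where
  at : ∀ n m → n ≡ suc a + m →
    fromℕ (3 ^ a) ℚ.* (1ℚ ℚ.+ fromℕ (2 ^ n) ℚ.* x) ≡ fromℕ (partialSum a (suc m)) →
    fromℕ (3 ^ suc a) ℚ.* (1ℚ ℚ.+ fromℕ (2 ^ n) ℚ.* (x ℚ.+ summand n (suc a))) ≡ fromℕ (partialSum (suc a) m)
  at _ m refl = scaled-step a m x

-- The telescoping starts from the empty sum one index before the lower limit. The bound on `a + a`
-- says that the partial sum there is still full, namely the power of 3 in front.
scaled-sumFromTo : ∀ n a i .{{_ : NonZero a}} → a + a ≤ suc n → a ≤ i → i ≤ n →
  Scaled n i (sumFromTo a i (λ j → summand n j))
scaled-sumFromTo n (suc a) i 2a≤n a<i i≤n =
  subst₂ (Scaled n) a+len≡i (ℚₚ.+-identityˡ (sumFrom (suc a) (i ∸ a) (λ j → summand n j)))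
    (sumFrom-invariant (Scaled n) (λ j → summand n j) n (scaled-step-< n) a (i ∸ a) 0ℚ
      (subst (_≤ n) (sym a+len≡i) i≤n) base)
  where
  a+len≡i : a + (i ∸ a) ≡ i
  a+len≡i = ℕₚ.m+[n∸m]≡n (ℕₚ.<⇒≤ a<i)

  a<n∸a : a < n ∸ a
  a<n∸a = ℕₚ.m+n≤o⇒m≤o∸n (suc a) (subst (_≤ n) (ℕₚ.+-suc a a) (s≤s⁻¹ 2a≤n))

  base : Scaled n a 0ℚ
  base = begin
    fromℕ (3 ^ a) ℚ.* (1ℚ ℚ.+ fromℕ (2 ^ n) ℚ.* 0ℚ)  ≡⟨ solve 2 (λ A N → A :* (con 1ℚ :+ N :* con 0ℚ) := A) refl (fromℕ (3 ^ a)) (fromℕ (2 ^ n)) ⟩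
    fromℕ (3 ^ a)                                    ≡⟨ cong fromℕ (partialSum-full a<n∸a) ⟨
    fromℕ (partialSum a (n ∸ a))                     ∎

firstTerm : ∀ i k → let n = i + suc k in
  ((+ (2 ^ n * (i C (n ∸ i)))) ℚ./ (2 ^ suc i)) {{ℕₚ.m^n≢0 2 (suc i)}} ≡ fromℕ (2 ^ k * (i C suc k))
firstTerm i k = trans
  (cong (λ x → ((+ x) ℚ./ (2 ^ suc i)) {{ℕₚ.m^n≢0 2 (suc i)}})
        (trans (cong (λ m → 2 ^ (i + suc k) * (i C m)) (ℕₚ.m+n∸m≡n i (suc k))) numerator))
  (/-exact (2 ^ suc i) {{ℕₚ.m^n≢0 2 (suc i)}} (2 ^ k * (i C suc k)))
  where
  numerator : 2 ^ (i + suc k) * (i C suc k) ≡ 2 ^ suc i * (2 ^ k * (i C suc k))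
  numerator = begin
    2 ^ (i + suc k) * (i C suc k)        ≡⟨ cong (λ m → 2 ^ m * (i C suc k)) (ℕₚ.+-suc i k) ⟩
    2 ^ (suc i + k) * (i C suc k)        ≡⟨ cong (_* (i C suc k)) (ℕₚ.^-distribˡ-+-* 2 (suc i) k) ⟩
    2 ^ suc i * 2 ^ k * (i C suc k)      ≡⟨ ℕₚ.*-assoc (2 ^ suc i) (2 ^ k) (i C suc k) ⟩
    2 ^ suc i * (2 ^ k * (i C suc k))    ∎

-- Specialisation to the Stern degrees and the three ranges of i

open DegreeSequence e refl e-even e-odd

eCount≡count : ∀ i n → eCount i n ≡ count e i (2 ^ n)
eCount≡count i n = length-filter-range₁ e i (2 ^ n)

eCount-formula : ∀ i k → eCount i (i + suc k) ≡ partialSum i (suc k) + 2 ^ k * (i C suc k)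
eCount-formula i k = trans (eCount≡count i (i + suc k)) (count-formula i k)

eCount-≡0 : ∀ i n → n < i → eCount i n ≡ 0
eCount-≡0 i n n<i = trans (eCount≡count i n) (count-2^n-≡0 i n n<i)

halfUp+halfUp≤1+n : ∀ n → (n ∸ ⌊ n /2⌋) + (n ∸ ⌊ n /2⌋) ≤ suc n
halfUp+halfUp≤1+n n = subst (λ h → h + h ≤ suc n) (sym halfUp≡⌈n/2⌉)
  -- `⌈ n /2⌉` is by definition `⌊ suc n /2⌋`, so the doubled value is bounded by the two halves of
  -- n + 1.
  (ℕₚ.≤-trans (ℕₚ.+-monoʳ-≤ ⌈ n /2⌉ (ℕₚ.⌊n/2⌋≤⌈n/2⌉ (suc n)))
              (ℕₚ.≤-reflexive (ℕₚ.⌊n/2⌋+⌈n/2⌉≡n (suc n))))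
  where
  halfUp≡⌈n/2⌉ : n ∸ ⌊ n /2⌋ ≡ ⌈ n /2⌉
  halfUp≡⌈n/2⌉ = trans (cong (_∸ ⌊ n /2⌋) (sym (ℕₚ.⌊n/2⌋+⌈n/2⌉≡n n))) (ℕₚ.m+n∸m≡n ⌊ n /2⌋ ⌈ n /2⌉)

-- Beyond degree n the right side has no terms, and the left side vanishes because no index up to 2ⁿ
-- has degree above n.
H-coefficients : ∀ n → H n ≈ₚ sumₚ (map (λ i → monomial (+ eCount i n) i) (upTo (suc n)))
H-coefficients n i = trans (trans (coeff-generating e i (2 ^ n)) (cong +_ (sym (eCount≡count i n)))) (sym rhs)
  where
  rhs : coeff (sumₚ (map (λ i → monomial (+ eCount i n) i) (upTo (suc n)))) i ≡ + eCount i n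
  rhs with ℕₚ.<-≤-connex i (suc n)
  ... | inj₁ i<1+n = coeff-upTo-< (λ i → eCount i n) (suc n) i i<1+n
  ... | inj₂ n<i   = trans (coeff-upTo-≥ (λ i → eCount i n) (suc n) i n<i) (cong +_ (sym (eCount-≡0 i n n<i)))

eCount-low : ∀ i k → i < suc k → eCount i (i + suc k) ≡ 3 ^ i
eCount-low i k i<1+k = begin
  eCount i (i + suc k)                         ≡⟨ eCount-formula i k ⟩
  partialSum i (suc k) + 2 ^ k * (i C suc k)   ≡⟨ cong₂ (λ s c → s + 2 ^ k * c) (partialSum-full i<1+k) (k>n⇒nCk≡0 i<1+k) ⟩
  3 ^ i + 2 ^ k * 0                            ≡⟨ cong (λ x → 3 ^ i + x) (ℕₚ.*-zeroʳ (2 ^ k)) ⟩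
  3 ^ i + 0                                    ≡⟨ ℕₚ.+-identityʳ (3 ^ i) ⟩
  3 ^ i                                        ∎

eCount-middle : ∀ i k → let n = i + suc k in .{{_ : NonZero n}} →
  n ∸ ⌊ n /2⌋ ≤ i → fromℕ (eCount i n) ≡ middleValue n i
eCount-middle i k half≤i = begin
  fromℕ (eCount i n)
    ≡⟨ cong fromℕ (eCount-formula i k) ⟩
  fromℕ (partialSum i (suc k) + 2 ^ k * (i C suc k))
    ≡⟨ fromℕ-homo-+ (partialSum i (suc k)) (2 ^ k * (i C suc k)) ⟩
  fromℕ (partialSum i (suc k)) ℚ.+ fromℕ (2 ^ k * (i C suc k))
    ≡⟨ ℚₚ.+-comm (fromℕ (partialSum i (suc k))) (fromℕ (2 ^ k * (i C suc k))) ⟩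
  fromℕ (2 ^ k * (i C suc k)) ℚ.+ fromℕ (partialSum i (suc k))
    ≡⟨ cong₂ ℚ._+_ (sym (firstTerm i k)) (sym scaled) ⟩
  middleValue n i
    ∎
  where
  n = i + suc k
  scaled : fromℕ (3 ^ i) ℚ.* (1ℚ ℚ.+ fromℕ (2 ^ n) ℚ.* sumFromTo (n ∸ ⌊ n /2⌋) i {{halfUp≢0 n}} (λ j → summand n j))
           ≡ fromℕ (partialSum i (suc k))
  scaled = trans
    (scaled-sumFromTo n (n ∸ ⌊ n /2⌋) i {{halfUp≢0 n}} (halfUp+halfUp≤1+n n) half≤i (ℕₚ.m≤m+n i (suc k)))
    (cong (λ m → fromℕ (partialSum i m)) (ℕₚ.m+n∸m≡n i (suc k)))

mainTheorem7 : (n : ℕ) .{{_ : NonZero n}} →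
    (H n ≈ₚ sumₚ (map (λ i → monomial (+ eCount i n) i) (upTo (suc n))))
    × ((i : ℕ) → i ≤ n ∸ ⌊ n /2⌋ ∸ 1 → eCount i n ≡ 3 ^ i)
    × ((i : ℕ) → n ∸ ⌊ n /2⌋ ≤ i → i ≤ n ∸ 1 → fromℕ (eCount i n) ≡ middleValue n i)
    × (eCount n n ≡ 1)
mainTheorem7 n = H-coefficients n , low , middle , trans (eCount≡count n n) (count-diagonal n)
  where
  -- Truncated subtraction gives 0 ∸ 1 = 0, so the strict bound needs `m` nonzero.
  ≤∸1⇒< : ∀ {i m} .{{_ : NonZero m}} → i ≤ m ∸ 1 → i < m
  ≤∸1⇒< {m = suc m} i≤m = s≤s i≤m

  split : ∀ {i} → i < n → i + suc (n ∸ suc i) ≡ n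
  split {i} i<n = trans (ℕₚ.+-suc i (n ∸ suc i)) (ℕₚ.m+[n∸m]≡n i<n)

  low : (i : ℕ) → i ≤ n ∸ ⌊ n /2⌋ ∸ 1 → eCount i n ≡ 3 ^ i
  low i i≤ = subst (λ n → eCount i n ≡ 3 ^ i) (split i<n)
    (eCount-low i (n ∸ suc i) (ℕₚ.+-cancelˡ-≤ i (suc i) _ (ℕₚ.≤-trans 1+2i≤n (ℕₚ.≤-reflexive (sym (split i<n))))))
    where
    i<half : i < n ∸ ⌊ n /2⌋
    i<half = ≤∸1⇒< {{halfUp≢0 n}} i≤
    1+2i≤n : i + suc i ≤ n
    1+2i≤n = s≤s⁻¹ (ℕₚ.≤-trans (ℕₚ.+-mono-≤ i<half i<half) (halfUp+halfUp≤1+n n))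
    i<n : i < n
    i<n = ℕₚ.≤-trans i<half (ℕₚ.m∸n≤m n ⌊ n /2⌋)

  -- Generalising `m` lets `refl` rewrite it everywhere, including in its nonzero instance inside
  -- `middleValue`.
  middleAt : ∀ i k m .{{_ : NonZero m}} → i + suc k ≡ m → m ∸ ⌊ m /2⌋ ≤ i → fromℕ (eCount i m) ≡ middleValue m i
  middleAt i k _ refl half≤i = eCount-middle i k half≤i

  middle : (i : ℕ) → n ∸ ⌊ n /2⌋ ≤ i → i ≤ n ∸ 1 → fromℕ (eCount i n) ≡ middleValue n i
  middle i half≤i i≤ = middleAt i (n ∸ suc i) n (split (≤∸1⇒< i≤)) half≤i
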